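{- $\mathbf{GR}^\circ$ enjoys Lyndon interpolation property. Moreover, for all $\mathcal{L}_2$-formulas $A$ and $B$, if $\mathbf{GR}^\circ\vdash A\to B$, then there exists an $\mathcal{L}_2$-formula $C$ with $v^+(C)\subseteq v^+(A)\cap v^+(B)$, $v^-(C)\subseteq v^-(A)\cap v^-(B)$, $\mathbf{GR}^\circ\vdash A\to C$ and $\mathbf{GR}^\circ\vdash C\to B$, which additionally satisfies: for each $*\in\{+,-\}$ and each $\mathcal{L}_2$-formula $D$, if $\blacksquare D\in S^*(C)$ then $\blacksquare D\in S^*(A)\cap S^*(B)$.
   Context: $\mathcal{L}_2$ is the bimodal propositional language with countably many propositional variables, $\bot$, connectives $\neg,\vee$ (others defined), and unary modal operators $\Box,\blacksquare$; $\Diamond$ abbreviates $\neg\Box\neg$. The logic $\mathbf{GR}^-$ has as axioms all propositional tautologies of $\mathcal{L}_2$ and all instances of $\Box(A\to B)\to(\Box A\to\Box B)$, $\Box(\Box A\to A)\to\Box A$, $\blacksquare A\to\Box A$, $\Box A\to\Box\blacksquare A$, $\Box A\to(\Box\bot\vee\blacksquare A)$, $\Diamond\blacksquare A\to\Diamond A$, and rules modus ponens and $\Box$-necessitation. $\mathbf{GR}^\circ$ is $\mathbf{GR}^-$ plus the rule: from $A$ infer $\blacksquare A$. Positive and negative subformulas: $S^+(A)=\{A\}$ and $S^-(A)=\emptyset$ if $A$ is a variable or $\bot$; $S^+(B\vee C)=S^+(B)\cup S^+(C)\cup\{B\vee C\}$, $S^-(B\vee C)=S^-(B)\cup S^-(C)$;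 $S^+(\neg B)=S^-(B)\cup\{\neg B\}$, $S^-(\neg B)=S^+(B)$; for $\circledast\in\{\Box,\blacksquare\}$, $S^+(\circledast B)=S^+(B)\cup\{\circledast B\}$, $S^-(\circledast B)=S^-(B)$. $v(A)$ is the set of variables occurring in $A$ and $v^*(A)=S^*(A)\cap v(A)$ for $*\in\{+,-\}$. A logic $L$ has Lyndon interpolation property if whenever $L\vdash A\to B$ there is $C$ with $v^*(C)\subseteq v^*(A)\cap v^*(B)$ for $*\in\{+,-\}$, $L\vdash A\to C$ and $L\vdash C\to B$. -}

module Defs where

open import Data.Nat using (ℕ)
open import Data.Bool using (Bool; true; false; not; _∨_)
open import Data.Product using (_×_)
open import Relation.Binary.PropositionalEquality using (_≡_)

data Fml : Set where
  var  : ℕ → Fml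
  ⊥'   : Fml
  ¬'_  : Fml → Fml
  _∨'_ : Fml → Fml → Fml
  □_   : Fml → Fml
  ■_   : Fml → Fml

infixr 6 _∨'_
infixr 5 _⇒_
infix 7 ¬'_ □_ ■_ ◇_

_⇒_ : Fml → Fml → Fml
A ⇒ B = (¬' A) ∨' B

◇_ : Fml → Fml
◇ A = ¬' (□ (¬' A))

eval : (Fml → Bool) → Fml → Bool
eval w (var n)  = w (var n)
eval w ⊥'       = false
eval w (¬' A)   = not (eval w A)
eval w (A ∨' B) = eval w A ∨ eval w B
eval w (□ A)    = w (□ A)
eval w (■ A)    = w (■ A)

Tautology : Fml → Set
Tautology A = (w : Fml → Bool) → eval w A ≡ true

data AxiomGR⁻ : Fml → Set where
  taut  : ∀ {A} → Tautology A → AxiomGR⁻ A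
  axK   : ∀ A B → AxiomGR⁻ (□ (A ⇒ B) ⇒ (□ A ⇒ □ B))
  axL   : ∀ A → AxiomGR⁻ (□ (□ A ⇒ A) ⇒ □ A)
  ax■□  : ∀ A → AxiomGR⁻ (■ A ⇒ □ A)
  ax□■  : ∀ A → AxiomGR⁻ (□ A ⇒ □ (■ A))
  ax□⊥  : ∀ A → AxiomGR⁻ (□ A ⇒ (□ ⊥' ∨' ■ A))
  ax◇■  : ∀ A → AxiomGR⁻ (◇ (■ A) ⇒ ◇ A)

data GR°⊢_ : Fml → Set where
  ax   : ∀ {A} → AxiomGR⁻ A → GR°⊢ A
  mp   : ∀ {A B} → GR°⊢ (A ⇒ B) → GR°⊢ A → GR°⊢ B
  nec□ : ∀ {A} → GR°⊢ A → GR°⊢ (□ A)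
  nec■ : ∀ {A} → GR°⊢ A → GR°⊢ (■ A)

data Pol : Set where
  pos neg : Pol

flip : Pol → Pol
flip pos = neg
flip neg = pos

data _∈S[_]_ : Fml → Pol → Fml → Set where
  here-var : ∀ {n} → var n ∈S[ pos ] var n
  here-⊥   : ⊥' ∈S[ pos ] ⊥'
  here-∨   : ∀ {B C} → (B ∨' C) ∈S[ pos ] (B ∨' C)
  here-¬   : ∀ {B} → (¬' B) ∈S[ pos ] (¬' B)
  here-□   : ∀ {B} → (□ B) ∈S[ pos ] (□ B)
  here-■   : ∀ {B} → (■ B) ∈S[ pos ] (■ B)
  ∨ˡ : ∀ {D p B C} → D ∈S[ p ] B → D ∈S[ p ] (B ∨' C)
  ∨ʳ : ∀ {D p B C} → D ∈S[ p ] C → D ∈S[ p ] (B ∨' C)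
  ¬- : ∀ {D p B} → D ∈S[ flip p ] B → D ∈S[ p ] (¬' B)
  □- : ∀ {D p B} → D ∈S[ p ] B → D ∈S[ p ] (□ B)
  ■- : ∀ {D p B} → D ∈S[ p ] B → D ∈S[ p ] (■ B)

-- n ∈ v^*(A)  iff  var n ∈ S^*(A)   (v^*(A) = S^*(A) ∩ v(A))
_∈v[_]_ : ℕ → Pol → Fml → Set
n ∈v[ p ] A = var n ∈S[ p ] A

{-# OPTIONS --safe #-}

-- ■D is treated as a propositional letter.  Put E = ¬B.  A type of A decides all atoms of A, and a
-- pair of types (G , H) of A and E is separable if some C in the language of common signed letters
-- satisfies G ⊢ C and H ⊢ ¬C.  For every pair one finds a separator or a finite tree whose nodes are
-- labelled by pairs: if all candidate successors required by ¬□X ∈ G are separable, then the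
-- separators combine to some C, and ◇C separates (G , H).  By Löb's axiom the successors may be taken
-- to contain □X, so the search terminates.  The language is fixed by A and E and not by the current
-- types, so adding □X does no harm to polarities, although X then occurs with both signs.
--
-- In a tree ■ coincides with □ at inner nodes; at a leaf ■D is free unless D is constant below the
-- predecessor, or the leaf is the root and D is provable.  GR° is sound for these trees, and
-- the tree of an inseparable pair refutes A → B.
module Submission where

open import Defs
open import Data.Bool using (Bool; true; false; not; _∧_; _∨_; if_then_else_)
open import Data.Bool.ListAction using (all)
open import Data.Bool.Properties using (∨-comm) renaming (_≟_ to _≟ᵇ_)
open import Data.Empty using (⊥; ⊥-elim)
open import Data.List using (List; []; _∷_; _++_; concatMap)
open import Data.List.Membership.Propositional using (_∈_; _∉_; find; lose)
open import Data.List.Membership.Propositional.Properties using (∈-++⁺ˡ; ∈-++⁺ʳ; ∈-++⁻; ∈-concatMap⁺; ∈-concatMap⁻)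
open import Data.List.Relation.Binary.Subset.Propositional using (_⊆_)
open import Data.List.Relation.Unary.All as All using (All; []; _∷_; lookup)
open import Data.List.Relation.Unary.All.Properties as All using ()
open import Data.List.Relation.Unary.Any using (Any; here; there; any?)
open import Data.List.Relation.Unary.Any.Properties using (++⁺ˡ; ++⁺ʳ)
open import Data.Maybe using (Maybe; just; nothing)
open import Data.Nat using (ℕ; suc; _+_; _≤_; _<_; z≤n; s≤s)
open import Data.Nat.Properties using (≤-refl; ≤-trans; m≤n⇒m≤1+n; +-mono-<-≤; +-mono-≤-<)
open import Data.Product using (Σ; ∃; _×_; _,_; proj₁; proj₂; uncurry; swap)
open import Data.Sum using (_⊎_; inj₁; inj₂; [_,_]′; map; map₁; map₂)
open import Data.Unit using (⊤; tt)
open import Function using (_∘_; id)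
open import Relation.Binary.Definitions using (DecidableEquality)
open import Relation.Binary.PropositionalEquality using (_≡_; refl; sym; trans; cong; cong₂; subst)
open import Relation.Nullary using (¬_; Dec; yes; no; does)
open import Relation.Nullary.Decidable using (map′; _×-dec_)
import Data.Nat as ℕ

-- Decidable equality of formulas

_≟_ : DecidableEquality Fml
var m ≟ var n = map′ (cong var) (λ { refl → refl }) (m ℕ.≟ n)
⊥' ≟ ⊥' = yes refl
(¬' A) ≟ (¬' B) = map′ (cong ¬'_) (λ { refl → refl }) (A ≟ B)
(A ∨' B) ≟ (C ∨' D) = map′ (uncurry (cong₂ _∨'_)) (λ { refl → refl , refl }) (A ≟ C ×-dec B ≟ D)
(□ A) ≟ (□ B) = map′ (cong □_) (λ { refl → refl }) (A ≟ B)
(■ A) ≟ (■ B) = map′ (cong ■_) (λ { refl → refl }) (A ≟ B)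
var _ ≟ ⊥' = no λ ()
var _ ≟ (¬' _) = no λ ()
var _ ≟ (_ ∨' _) = no λ ()
var _ ≟ (□ _) = no λ ()
var _ ≟ (■ _) = no λ ()
⊥' ≟ var _ = no λ ()
⊥' ≟ (¬' _) = no λ ()
⊥' ≟ (_ ∨' _) = no λ ()
⊥' ≟ (□ _) = no λ ()
⊥' ≟ (■ _) = no λ ()
(¬' _) ≟ var _ = no λ ()
(¬' _) ≟ ⊥' = no λ ()
(¬' _) ≟ (_ ∨' _) = no λ ()
(¬' _) ≟ (□ _) = no λ ()
(¬' _) ≟ (■ _) = no λ ()
(_ ∨' _) ≟ var _ = no λ ()
(_ ∨' _) ≟ ⊥' = no λ ()
(_ ∨' _) ≟ (¬' _) = no λ ()
(_ ∨' _) ≟ (□ _) = no λ ()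
(_ ∨' _) ≟ (■ _) = no λ ()
(□ _) ≟ var _ = no λ ()
(□ _) ≟ ⊥' = no λ ()
(□ _) ≟ (¬' _) = no λ ()
(□ _) ≟ (_ ∨' _) = no λ ()
(□ _) ≟ (■ _) = no λ ()
(■ _) ≟ var _ = no λ ()
(■ _) ≟ ⊥' = no λ ()
(■ _) ≟ (¬' _) = no λ ()
(■ _) ≟ (_ ∨' _) = no λ ()
(■ _) ≟ (□ _) = no λ ()

open import Data.List.Membership.DecPropositional _≟_ using (_∈?_)

private
  variable
    A B C D E F X Y Z : Fml
    G H Γ Δ : List Fml
    p q : Pol
    P : Set

-- Polarities

infixl 8 _·_

_·_ : Pol → Pol → Pol
p · pos = p
p · neg = flip p

pos·_ : ∀ q → pos · q ≡ q
pos· pos = refl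
pos· neg = refl

flip-· : ∀ p q → flip (p · q) ≡ flip p · q
flip-· p pos = refl
flip-· p neg = refl

flip·flip : ∀ p q → flip p · flip q ≡ p · q
flip·flip pos pos = refl
flip·flip pos neg = refl
flip·flip neg pos = refl
flip·flip neg neg = refl

sgn : Pol → Bool
sgn pos = true
sgn neg = false

∈S-refl : ∀ X → X ∈S[ pos ] X
∈S-refl (var _)  = here-var
∈S-refl ⊥'       = here-⊥
∈S-refl (¬' _)   = here-¬
∈S-refl (_ ∨' _) = here-∨
∈S-refl (□ _)    = here-□
∈S-refl (■ _)    = here-■

-- Signs multiply along nested occurrences, since only negation changes a sign.
∈S-trans : Y ∈S[ q ] X → X ∈S[ p ] A → Y ∈S[ p · q ] A
∈S-trans {q = q} d here-var rewrite pos· q = d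
∈S-trans {q = q} d here-⊥   rewrite pos· q = d
∈S-trans {q = q} d here-∨   rewrite pos· q = d
∈S-trans {q = q} d here-¬   rewrite pos· q = d
∈S-trans {q = q} d here-□   rewrite pos· q = d
∈S-trans {q = q} d here-■   rewrite pos· q = d
∈S-trans d (∨ˡ e) = ∨ˡ (∈S-trans d e)
∈S-trans d (∨ʳ e) = ∨ʳ (∈S-trans d e)
∈S-trans {q = q} {p = p} d (¬- e) = ¬- (subst (_ ∈S[_] _) (sym (flip-· p q)) (∈S-trans d e))
∈S-trans d (□- e) = □- (∈S-trans d e)
∈S-trans d (■- e) = ■- (∈S-trans d e)

data Letter : Fml → Set where
  var : ∀ {n} → Letter (var n)
  ■_  : ∀ D → Letter (■ D)

letters : Fml → Pol → List Fml
letters (var n)  pos = var n ∷ []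
letters (var n)  neg = []
letters ⊥'       p   = []
letters (¬' B)   p   = letters B (flip p)
letters (B ∨' C) p   = letters B p ++ letters C p
letters (□ B)    p   = letters B p
letters (■ B)    pos = ■ B ∷ letters B pos
letters (■ B)    neg = letters B neg

letters-sound : ∀ A p → X ∈ letters A p → Letter X × X ∈S[ p ] A
letters-sound (var n) pos (here refl) = var , here-var
letters-sound (¬' B) p i = let l , d = letters-sound B (flip p) i in l , ¬- d
letters-sound (B ∨' C) p i with ∈-++⁻ (letters B p) i
... | inj₁ j = let l , d = letters-sound B p j in l , ∨ˡ d
... | inj₂ j = let l , d = letters-sound C p j in l , ∨ʳ d
letters-sound (□ B) p i = let l , d = letters-sound B p i in l , □- d
letters-sound (■ B) pos (here refl) = ■ B , here-■
letters-sound (■ B) pos (there i) = let l , d = letters-sound B pos i in l , ■- d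
letters-sound (■ B) neg i = let l , d = letters-sound B neg i in l , ■- d

letters-complete : Letter X → X ∈S[ p ] A → X ∈ letters A p
letters-complete l here-var = here refl
letters-complete l here-■   = here refl
letters-complete l (∨ˡ d)   = ∈-++⁺ˡ (letters-complete l d)
letters-complete {p = p} l (∨ʳ {B = B} d) = ∈-++⁺ʳ (letters B p) (letters-complete l d)
letters-complete l (¬- d)   = letters-complete l d
letters-complete l (□- d)   = letters-complete l d
letters-complete {p = pos} l (■- d) = there (letters-complete l d)
letters-complete {p = neg} l (■- d) = letters-complete l d

-- The boxes □D and □¬D are added for every ■D because the value of ■D at a leaf
-- depends on whether D is constant below the predecessor of that leaf.
atoms : Fml → List Fml
atoms (var n)  = var n ∷ []
atoms ⊥'       = []
atoms (¬' B)   = atoms B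
atoms (B ∨' C) = atoms B ++ atoms C
atoms (□ B)    = □ B ∷ atoms B
atoms (■ B)    = ■ B ∷ □ B ∷ □ ¬' B ∷ atoms B

atoms-closed : ∀ A → X ∈ atoms A → atoms X ⊆ atoms A
atoms-closed (var n) (here refl) j = j
atoms-closed (¬' B) i j = atoms-closed B i j
atoms-closed (B ∨' C) i j with ∈-++⁻ (atoms B) i
... | inj₁ k = ∈-++⁺ˡ (atoms-closed B k j)
... | inj₂ k = ∈-++⁺ʳ (atoms B) (atoms-closed C k j)
atoms-closed (□ B) (here refl) j = j
atoms-closed (□ B) (there i) j = there (atoms-closed B i j)
atoms-closed (■ B) (here refl) j = j
atoms-closed (■ B) (there (here refl)) (here refl) = there (here refl)
atoms-closed (■ B) (there (here refl)) (there j) = there (there (there j))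
atoms-closed (■ B) (there (there (here refl))) j = there (there j)
atoms-closed (■ B) (there (there (there i))) j = there (there (there (atoms-closed B i j)))

∈S⇒atoms : X ∈S[ p ] A → atoms X ⊆ atoms A
∈S⇒atoms here-var j = j
∈S⇒atoms here-∨ j = j
∈S⇒atoms here-¬ j = j
∈S⇒atoms here-□ j = j
∈S⇒atoms here-■ j = j
∈S⇒atoms (∨ˡ d) j = ∈-++⁺ˡ (∈S⇒atoms d j)
∈S⇒atoms (∨ʳ {B = B} d) j = ∈-++⁺ʳ (atoms B) (∈S⇒atoms d j)
∈S⇒atoms (¬- d) j = ∈S⇒atoms d j
∈S⇒atoms (□- d) j = there (∈S⇒atoms d j)
∈S⇒atoms (■- d) j = there (there (there (∈S⇒atoms d j)))

letter∈atoms : Letter X → X ∈S[ p ] A → X ∈ atoms A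
letter∈atoms var   d = ∈S⇒atoms d (here refl)
letter∈atoms (■ D) d = ∈S⇒atoms d (here refl)

-- Derivability from hypotheses

infix 4 _⊢_

-- Necessitation enters only through `thm`, never applied to hypotheses; this is what makes
-- `deduction` hold.
data _⊢_ (Γ : List Fml) : Fml → Set where
  hyp : X ∈ Γ → Γ ⊢ X
  thm : GR°⊢ X → Γ ⊢ X
  app : Γ ⊢ (X ⇒ Y) → Γ ⊢ X → Γ ⊢ Y

axiom : AxiomGR⁻ X → Γ ⊢ X
axiom a = thm (ax a)

taut-id : Tautology (X ⇒ X)
taut-id {X} w with eval w X
... | true  = refl
... | false = refl

taut-K : Tautology (X ⇒ Y ⇒ X)
taut-K {X} {Y} w with eval w X | eval w Y
... | true  | true  = refl
... | true  | false = refl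
... | false | _     = refl

taut-S : Tautology ((X ⇒ Y ⇒ Z) ⇒ (X ⇒ Y) ⇒ (X ⇒ Z))
taut-S {X} {Y} {Z} w with eval w X | eval w Y | eval w Z
... | true  | true  | true  = refl
... | true  | true  | false = refl
... | true  | false | _     = refl
... | false | true  | true  = refl
... | false | true  | false = refl
... | false | false | true  = refl
... | false | false | false = refl

taut-absurd : Tautology (X ⇒ ¬' X ⇒ Y)
taut-absurd {X} w with eval w X
... | true  = refl
... | false = refl

taut-cases : Tautology ((X ⇒ Y) ⇒ (¬' X ⇒ Y) ⇒ Y)
taut-cases {X} {Y} w with eval w X | eval w Y
... | true  | true  = refl
... | true  | false = refl
... | false | true  = refl
... | false | false = refl

taut-∨ˡ : Tautology (X ⇒ X ∨' Y)
taut-∨ˡ {X} w with eval w X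
... | true  = refl
... | false = refl

taut-∨ʳ : Tautology (Y ⇒ X ∨' Y)
taut-∨ʳ {Y} {X} w with eval w X | eval w Y
... | true  | true  = refl
... | true  | false = refl
... | false | true  = refl
... | false | false = refl

taut-¬∨ : Tautology (¬' X ⇒ ¬' Y ⇒ ¬' (X ∨' Y))
taut-¬∨ {X} {Y} w with eval w X | eval w Y
... | true  | _     = refl
... | false | true  = refl
... | false | false = refl

deduction : (X ∷ Γ) ⊢ Y → Γ ⊢ (X ⇒ Y)
deduction {X = X} (hyp (here refl)) = axiom (taut (taut-id {X}))
deduction {X = X} {Y = Y} (hyp (there i)) = app (axiom (taut (taut-K {Y} {X}))) (hyp i)
deduction {X = X} {Y = Y} (thm d) = app (axiom (taut (taut-K {Y} {X}))) (thm d)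
deduction {X = X} {Y = Y} (app {X = Z} d e) =
  app (app (axiom (taut (taut-S {X} {Z} {Y}))) (deduction d)) (deduction e)

cut : (∀ {F} → F ∈ Γ → Δ ⊢ F) → Γ ⊢ X → Δ ⊢ X
cut σ (hyp i)   = σ i
cut σ (thm d)   = thm d
cut σ (app d e) = app (cut σ d) (cut σ e)

weaken : Γ ⊢ X → (Y ∷ Γ) ⊢ X
weaken = cut (hyp ∘ there)

theorem : [] ⊢ X → GR°⊢ X
theorem (thm d)   = d
theorem (app d e) = mp (theorem d) (theorem e)

box : (∀ {F} → F ∈ Γ → Δ ⊢ (□ F)) → Γ ⊢ X → Δ ⊢ (□ X)
box σ (hyp i) = σ i
box σ (thm d) = thm (nec□ d)
box σ (app {X = X} {Y = Y} d e) = app (app (axiom (axK X Y)) (box σ d)) (box σ e)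

absurd : Γ ⊢ X → Γ ⊢ (¬' X) → Γ ⊢ Y
absurd {X = X} {Y = Y} d e = app (app (axiom (taut (taut-absurd {X} {Y}))) d) e

cases : (X ∷ Γ) ⊢ Y → ((¬' X) ∷ Γ) ⊢ Y → Γ ⊢ Y
cases {X = X} {Y = Y} d e = app (app (axiom (taut (taut-cases {X} {Y}))) (deduction d)) (deduction e)

¬-intro : (X ∷ Γ) ⊢ ⊥' → Γ ⊢ (¬' X)
¬-intro d = cases (absurd d (axiom (taut λ _ → refl))) (hyp (here refl))

by-contradiction : ((¬' X) ∷ Γ) ⊢ ⊥' → Γ ⊢ X
by-contradiction d = cases (hyp (here refl)) (absurd d (axiom (taut λ _ → refl)))

∨-introˡ : Γ ⊢ X → Γ ⊢ (X ∨' Y)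
∨-introˡ {X = X} {Y = Y} = app (axiom (taut (taut-∨ˡ {X} {Y})))

∨-introʳ : Γ ⊢ Y → Γ ⊢ (X ∨' Y)
∨-introʳ {Y = Y} {X = X} = app (axiom (taut (taut-∨ʳ {Y} {X})))

¬∨-intro : Γ ⊢ (¬' X) → Γ ⊢ (¬' Y) → Γ ⊢ (¬' (X ∨' Y))
¬∨-intro {X = X} {Y = Y} d e = app (app (axiom (taut (taut-¬∨ {X} {Y}))) d) e

contrapose : Γ ⊢ (¬' X ⇒ ¬' Y) → Γ ⊢ (Y ⇒ X)
contrapose d = deduction (by-contradiction
  (absurd (hyp (there (here refl))) (app (weaken (weaken d)) (hyp (here refl)))))

∨-elim : Γ ⊢ (X ∨' Y) → Γ ⊢ (¬' Y) → Γ ⊢ X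
∨-elim d e = by-contradiction (absurd (weaken d) (¬∨-intro (hyp (here refl)) (weaken e)))

■⇒□ : Γ ⊢ (■ X) → Γ ⊢ (□ X)
■⇒□ {X = X} = app (axiom (ax■□ X))

□⇒□■ : Γ ⊢ (□ X) → Γ ⊢ (□ ■ X)
□⇒□■ {X = X} = app (axiom (ax□■ X))

-- Transitivity comes from passing through `□ ■ X` rather than from Löb's axiom.
□⇒□□ : Γ ⊢ (□ X) → Γ ⊢ (□ □ X)
□⇒□□ {X = X} d = app (app (axiom (axK (■ X) (□ X))) (thm (nec□ (ax (ax■□ X))))) (□⇒□■ d)

□¬⇒□¬■ : Γ ⊢ (□ ¬' X) → Γ ⊢ (□ ¬' (■ X))
□¬⇒□¬■ {X = X} = app (contrapose (axiom (ax◇■ X)))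

-- Rosser trees

record Label : Set where
  field
    left right : List Fml
    val        : Fml → Bool

open Label

data Tree : Set where
  node : Label → List Tree → Tree

-- A node together with the list of its siblings (including itself), or nothing at a root.
Point : Set
Point = Maybe (List Tree) × Tree

-- The list `ds` stays fixed while `ts` is consumed, so that each point remembers all its siblings.
points : List Tree → List Tree → List Point
points ds []               = []
points ds (node ℓ cs ∷ ts) = (just ds , node ℓ cs) ∷ points cs cs ++ points ds ts

below : List Tree → List Point
below cs = points cs cs

-- The arguments say whether D holds everywhere, and whether it fails everywhere, below the
-- predecessor; the third is the free value.
rosser : Bool → Bool → Bool → Bool
rosser true  _     _ = true
rosser false true  _ = false
rosser false false b = b

-- At an inner node ■ is □.  At a leaf the value of ■D is free, except that it is
-- forced when D is constant strictly below the predecessor of the leaf.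
sat : Fml → Point → Bool
sat (var n)  (_ , node ℓ _)  = val ℓ (var n)
sat ⊥'       x = false
sat (¬' X)   x = not (sat X x)
sat (X ∨' Y) x = sat X x ∨ sat Y x
sat (□ X)    (_ , node _ cs) = all (sat X) (below cs)
sat (■ X)    (_ , node _ (c ∷ cs)) = all (sat X) (below (c ∷ cs))
sat (■ X)    (nothing , node ℓ []) = val ℓ (■ X)
sat (■ X)    (just ds , node ℓ []) =
  rosser (all (sat X) (below ds)) (all (λ x → not (sat X x)) (below ds)) (val ℓ (■ X))

data Below : List Tree → Point → Set where
  child : ∀ {cs t} → t ∈ cs → Below cs (just cs , t)
  deep  : ∀ {ℓ cs ds x} → node ℓ ds ∈ cs → Below ds x → Below cs x

points-child : ∀ {ds ts t} → t ∈ ts → (just ds , t) ∈ points ds ts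
points-child {ts = node _ _ ∷ _} (here refl) = here refl
points-child {ts = node _ cs ∷ _} (there i) = there (∈-++⁺ʳ (below cs) (points-child i))

points-deep : ∀ {ℓ cs ds ts x} → node ℓ cs ∈ ts → x ∈ below cs → x ∈ points ds ts
points-deep (here refl) j = there (∈-++⁺ˡ j)
points-deep {ts = node _ cs ∷ _} (there i) j = there (∈-++⁺ʳ (below cs) (points-deep i j))

Below⇒∈ : ∀ {cs x} → Below cs x → x ∈ below cs
Below⇒∈ (child i)  = points-child i
Below⇒∈ (deep i b) = points-deep i (Below⇒∈ b)

∈-points⁻ : ∀ {ds} ts {x} → ts ⊆ ds → x ∈ points ds ts → Below ds x
∈-points⁻ (node ℓ cs ∷ ts) s (here refl) = child (s (here refl))
∈-points⁻ (node ℓ cs ∷ ts) s (there i) with ∈-++⁻ (below cs) i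
... | inj₁ j = deep (s (here refl)) (∈-points⁻ cs id j)
... | inj₂ j = ∈-points⁻ ts (s ∘ there) j

∈⇒Below : ∀ {cs x} → x ∈ below cs → Below cs x
∈⇒Below {cs} = ∈-points⁻ cs id

Below-trans : ∀ {cs s ℓ ds x} → Below cs (s , node ℓ ds) → Below ds x → Below cs x
Below-trans (child i)  b = deep i b
Below-trans (deep i a) b = deep i (Below-trans a b)

-- The sibling list `ds` is either `cs` itself or lies deeper in it.
Below-sibling : ∀ {cs ds t x} → Below cs (just ds , t) → Below ds x → Below cs x
Below-sibling (child i)  b = b
Below-sibling (deep i a) b = deep i (Below-sibling a b)

Below-self : ∀ {cs ds t} → Below cs (just ds , t) → Below ds (just ds , t)
Below-self (child i)  = child i
Below-self (deep _ a) = Below-self a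

∧-true : ∀ {a b} → a ≡ true → b ≡ true → a ∧ b ≡ true
∧-true refl refl = refl

all-true⁺ : ∀ {T : Set} (f : T → Bool) xs → (∀ {x} → x ∈ xs → f x ≡ true) → all f xs ≡ true
all-true⁺ f []       h = refl
all-true⁺ f (x ∷ xs) h = ∧-true (h (here refl)) (all-true⁺ f xs (h ∘ there))

all-true⁻ : ∀ {T : Set} (f : T → Bool) {xs x} → all f xs ≡ true → x ∈ xs → f x ≡ true
all-true⁻ f {x ∷ _} e i with f x in eq
all-true⁻ f () i           | false
all-true⁻ f e (here refl)  | true = eq
all-true⁻ f e (there i)    | true = all-true⁻ f e i

not-true⁻ : ∀ {a} → not a ≡ true → a ≡ false
not-true⁻ {false} _ = refl

not-false⁻ : ∀ {a} → not a ≡ false → a ≡ true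
not-false⁻ {true} _ = refl

true≢false : ∀ {a} → a ≡ true → a ≡ false → ⊥
true≢false refl ()

≢false⇒true : ∀ {a} → ¬ (a ≡ false) → a ≡ true
≢false⇒true {true}  n = refl
≢false⇒true {false} n = ⊥-elim (n refl)

≢true⇒false : ∀ {a} → ¬ (a ≡ true) → a ≡ false
≢true⇒false {true}  n = ⊥-elim (n refl)
≢true⇒false {false} n = refl

□⁺ : ∀ X cs → (∀ {x} → Below cs x → sat X x ≡ true) → all (sat X) (below cs) ≡ true
□⁺ X cs h = all-true⁺ (sat X) _ (h ∘ ∈⇒Below)

□⁻ : ∀ X {cs x} → all (sat X) (below cs) ≡ true → Below cs x → sat X x ≡ true
□⁻ X e b = all-true⁻ (sat X) e (Below⇒∈ b)

□-refute : ∀ X {cs x} → Below cs x → sat X x ≡ false → all (sat X) (below cs) ≡ false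
□-refute X b e = ≢true⇒false λ e′ → true≢false (□⁻ X e′ b) e

⇒⁺ : ∀ X Y x → (sat X x ≡ true → sat Y x ≡ true) → sat (X ⇒ Y) x ≡ true
⇒⁺ X Y x h with sat X x
... | true  = h refl
... | false = refl

⇒⁻ : ∀ {a b} → not a ∨ b ≡ true → a ≡ true → b ≡ true
⇒⁻ e refl = e

rosser-false : ∀ {a b} c → a ≡ false → b ≡ true → rosser a b c ≡ false
rosser-false c refl refl = refl

-- The condition at a root makes the rule of ■-necessitation sound there.
data Admissible : Point → Set where
  root  : ∀ {ℓ cs} → (∀ {D} → GR°⊢ D → val ℓ (■ D) ≡ true) → Admissible (nothing , node ℓ cs)
  inner : ∀ {ds t} → t ∈ ds → Admissible (just ds , t)

Below⇒Admissible : ∀ {cs x} → Below cs x → Admissible x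
Below⇒Admissible (child i)  = inner i
Below⇒Admissible (deep _ b) = Below⇒Admissible b

-- Soundness for Rosser trees

sat≡eval : ∀ X x → eval (λ Y → sat Y x) X ≡ sat X x
sat≡eval (var n)  x = refl
sat≡eval ⊥'       x = refl
sat≡eval (¬' X)   x = cong not (sat≡eval X x)
sat≡eval (X ∨' Y) x = cong₂ _∨_ (sat≡eval X x) (sat≡eval Y x)
sat≡eval (□ X)    x = refl
sat≡eval (■ X)    x = refl

-- Induction on the finite forest: X holds at everything below the head, hence `□ X` holds at the
-- head, hence X does.
löb : ∀ X ds ts → (∀ {x} → x ∈ points ds ts → sat (□ X ⇒ X) x ≡ true) →
      ∀ {x} → x ∈ points ds ts → sat X x ≡ true
löb X ds (node ℓ cs ∷ ts) h (here refl) =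
  ⇒⁻ (h (here refl)) (all-true⁺ (sat X) _ (löb X cs cs (h ∘ there ∘ ∈-++⁺ˡ)))
löb X ds (node ℓ cs ∷ ts) h (there i) with ∈-++⁻ (below cs) i
... | inj₁ j = löb X cs cs (h ∘ there ∘ ∈-++⁺ˡ) j
... | inj₂ j = löb X ds ts (h ∘ there ∘ ∈-++⁺ʳ (below cs)) j

■-true : ∀ X {cs x} → all (sat X) (below cs) ≡ true → Below cs x → sat (■ X) x ≡ true
■-true X {x = just ds , node ℓ []} e b
  rewrite □⁺ X ds (□⁻ X e ∘ Below-sibling b) = refl
■-true X {x = _ , node ℓ (c ∷ cs)} e b = □⁺ X (c ∷ cs) (□⁻ X e ∘ Below-trans b)
-- No point below a forest is a root; the recursion strips `deep` and has no base case.
■-true X {x = nothing , node ℓ []} e (deep i b) = ■-true X (□⁺ X _ (□⁻ X e ∘ deep i)) b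

-- At an inner node the first child refutes X. At a leaf X fails throughout below the predecessor,
-- and the leaf itself shows that X is not constantly true there.
■-false : ∀ X {cs x} → all (sat (¬' X)) (below cs) ≡ true → Below cs x → sat (■ X) x ≡ false
■-false X {x = just ds , node ℓ []} e b =
  rosser-false (val ℓ (■ X)) (□-refute X (Below-self b) (not-true⁻ (□⁻ (¬' X) e b)))
    (□⁺ (¬' X) ds (□⁻ (¬' X) e ∘ Below-sibling b))
■-false X {x = _ , node ℓ (c ∷ cs)} e b =
  □-refute X (child (here refl)) (not-true⁻ (□⁻ (¬' X) e (Below-trans b (child (here refl)))))
■-false X {x = nothing , node ℓ []} e (deep i b) = ■-false X (□⁺ (¬' X) _ (□⁻ (¬' X) e ∘ deep i)) b

sound-axiom : AxiomGR⁻ X → ∀ {x} → sat X x ≡ true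
sound-axiom {X} (taut t) {x} = trans (sym (sat≡eval X x)) (t _)
sound-axiom (axK A B) {x@(_ , node _ cs)} =
  ⇒⁺ (□ (A ⇒ B)) (□ A ⇒ □ B) x λ e → ⇒⁺ (□ A) (□ B) x λ f →
    □⁺ B cs λ b → ⇒⁻ (□⁻ (A ⇒ B) e b) (□⁻ A f b)
sound-axiom (axL A) {x@(_ , node _ cs)} =
  ⇒⁺ (□ (□ A ⇒ A)) (□ A) x λ e → all-true⁺ (sat A) _ (löb A cs cs (all-true⁻ (sat (□ A ⇒ A)) e))
sound-axiom (ax■□ A) {x@(_ , node _ [])} = ⇒⁺ (■ A) (□ A) x λ _ → refl
sound-axiom (ax■□ A) {x@(_ , node _ (_ ∷ _))} = ⇒⁺ (■ A) (□ A) x id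
sound-axiom (ax□■ A) {x@(_ , node _ cs)} = ⇒⁺ (□ A) (□ ■ A) x λ e → □⁺ (■ A) cs (■-true A e)
sound-axiom (ax□⊥ A) {_ , node _ []} = refl
sound-axiom (ax□⊥ A) {x@(_ , node _ (node _ _ ∷ _))} = ⇒⁺ (□ A) (□ ⊥' ∨' ■ A) x id
sound-axiom (ax◇■ A) {x@(_ , node _ cs)} =
  ⇒⁺ (◇ (■ A)) (◇ A) x λ e → cong not (≢true⇒false λ f →
    true≢false (□⁺ (¬' (■ A)) cs (λ b → cong not (■-false A f b))) (not-true⁻ e))

-- Axioms hold at every point. For ■-necessitation at a leaf, a root relies on admissibility, while
-- elsewhere the theorem holds at all points below the predecessor, which forces ■.
soundness : GR°⊢ X → ∀ {x} → Admissible x → sat X x ≡ true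
soundness (ax a) _ = sound-axiom a
soundness (mp d e) r = ⇒⁻ (soundness d r) (soundness e r)
soundness (nec□ {A} d) {_ , node _ cs} _ = □⁺ A cs (soundness d ∘ Below⇒Admissible)
soundness (nec■ {A} d) {_ , node _ cs@(_ ∷ _)} _ = □⁺ A cs (soundness d ∘ Below⇒Admissible)
soundness (nec■ {A} d) {_ , node _ []} (root f) = f d
soundness (nec■ {A} d) {just ds , node ℓ []} (inner i) =
  ■-true A {x = just ds , node ℓ []} (□⁺ A ds (soundness d ∘ Below⇒Admissible)) (child i)

-- Types: finite sets of formulas deciding all atoms of a formula

member : List Fml → Fml → Bool
member G X = does (X ∈? G)

member⁺ : X ∈ G → member G X ≡ true
member⁺ {X} {G} i with X ∈? G
... | yes _ = refl
... | no n  = ⊥-elim (n i)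

member⁻ : ∀ G X → member G X ≡ true → X ∈ G
member⁻ G X e with X ∈? G
member⁻ G X e  | yes i = i
member⁻ G X () | no _

nonmember⁻ : ∀ G X → member G X ≡ false → X ∉ G
nonmember⁻ G X e i = true≢false (member⁺ i) e

truth : List Fml → Fml → Bool
truth G = eval (member G)

record Decides (A : Fml) (G : List Fml) : Set where
  constructor deciding
  field
    decide : ∀ {X} → X ∈ atoms A → X ∈ G ⊎ (¬' X) ∈ G

open Decides

refuted : Decides A G → X ∈ atoms A → member G X ≡ false → G ⊢ (¬' X)
refuted {G = G} {X = X} δ i e = [ ⊥-elim ∘ nonmember⁻ G X e , hyp ]′ (decide δ i)

-- Kalmár's lemma: the literals in the type derive each formula over its atoms, or the negation,
-- according to the computed value.
truth-derivable : Decides A G → ∀ X → atoms X ⊆ atoms A →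
                  (truth G X ≡ true → G ⊢ X) × (truth G X ≡ false → G ⊢ (¬' X))
truth-derivable {G = G} δ (var n) s = hyp ∘ member⁻ G (var n) , refuted δ (s (here refl))
truth-derivable δ ⊥' s = (λ ()) , λ _ → axiom (taut λ _ → refl)
truth-derivable {G = G} δ (¬' X) s with truth-derivable δ X s
... | t , f = f ∘ not-true⁻ , λ e → ¬-intro (absurd (weaken (t (not-false⁻ e))) (hyp (here refl)))
truth-derivable {G = G} δ (X ∨' Y) s with truth-derivable δ X (s ∘ ∈-++⁺ˡ) | truth-derivable δ Y (s ∘ ∈-++⁺ʳ (atoms X))
... | t , f | t′ , f′ with truth G X | truth G Y
... | true  | _     = (λ _ → ∨-introˡ (t refl)) , λ ()
... | false | true  = (λ _ → ∨-introʳ (t′ refl)) , λ ()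
... | false | false = (λ ()) , λ _ → ¬∨-intro (f refl) (f′ refl)
truth-derivable {G = G} δ (□ X) s = hyp ∘ member⁻ G (□ X) , refuted δ (s (here refl))
truth-derivable {G = G} δ (■ X) s = hyp ∘ member⁻ G (■ X) , refuted δ (s (here refl))

-- Formulas F with G ⊢ □F that a successor of G is required to contain.
push■ : Bool → Bool → Bool → Fml → List Fml
push■ □D □¬D ■D D =
  -- By `ax□⊥`, a type with `□ D` but without `■ D` proves `□ ⊥'`; pushing `⊥'` forbids it any
  -- successor.
  (if □D then ■ D ∷ (if ■D then [] else ⊥' ∷ []) else []) ++
  -- This is the contrapositive of `ax◇■`.
  (if □¬D then ¬' (■ D) ∷ [] else []) ++
  (if ■D then D ∷ □ D ∷ [] else [])

push : List Fml → Fml → List Fml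
push G (□ X) = if member G (□ X) then X ∷ □ X ∷ [] else []
push G (■ D) = push■ (member G (□ D)) (member G (□ ¬' D)) (member G (■ D)) D
push G _     = []

pushed : Fml → List Fml → List Fml
pushed A G = concatMap (push G) (atoms A)

push-derivable : Decides A G → X ∈ atoms A → F ∈ push G X → G ⊢ (□ F) × atoms F ⊆ atoms A
push-derivable {A} {G} {□ X} δ i j with member G (□ X) in e
push-derivable {A} {G} {□ X} δ i (here refl) | true =
  hyp (member⁻ G (□ X) e) , atoms-closed A i ∘ there
push-derivable {A} {G} {□ X} δ i (there (here refl)) | true =
  □⇒□□ (hyp (member⁻ G (□ X) e)) , atoms-closed A i
push-derivable {A} {G} {■ D} δ i j
  with member G (□ D) in e₁ | member G (□ ¬' D) in e₂ | member G (■ D) in e₃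
... | b₁ | b₂ | b₃ = [ first b₁ b₃ e₁ e₃ , [ second b₂ e₂ , third b₃ e₃ ]′ ∘ ∈-++⁻ _ ]′ (∈-++⁻ _ j)
  where
  Goal : Fml → Set
  Goal F = G ⊢ (□ F) × atoms F ⊆ atoms A

  first : ∀ x z → member G (□ D) ≡ x → member G (■ D) ≡ z →
          F ∈ (if x then ■ D ∷ (if z then [] else ⊥' ∷ []) else []) → Goal F
  first true z e₁ e₃ (here refl) = □⇒□■ (hyp (member⁻ G (□ D) e₁)) , atoms-closed A i
  first true false e₁ e₃ (there (here refl)) =
    ∨-elim (app (axiom (ax□⊥ D)) (hyp (member⁻ G (□ D) e₁))) (refuted δ i e₃) , λ ()

  second : ∀ y → member G (□ ¬' D) ≡ y → F ∈ (if y then ¬' (■ D) ∷ [] else []) → Goal F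
  second true e₂ (here refl) = □¬⇒□¬■ (hyp (member⁻ G (□ ¬' D) e₂)) , atoms-closed A i

  third : ∀ z → member G (■ D) ≡ z → F ∈ (if z then D ∷ □ D ∷ [] else []) → Goal F
  third true e₃ (here refl) =
    ■⇒□ (hyp (member⁻ G (■ D) e₃)) , atoms-closed A i ∘ there ∘ there ∘ there
  third true e₃ (there (here refl)) =
    □⇒□□ (■⇒□ (hyp (member⁻ G (■ D) e₃))) ,
    λ { (here refl) → atoms-closed A i (there (here refl))
      ; (there k) → atoms-closed A i (there (there (there k))) }

pushed-derivable : ∀ A → Decides A G → F ∈ pushed A G → G ⊢ (□ F) × atoms F ⊆ atoms A
pushed-derivable {G = G} A δ j with find (∈-concatMap⁻ (push G) {xs = atoms A} j)
... | X , i , k = push-derivable {A} {G} {X} δ i k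

module _ (A : Fml) (G : List Fml) where

  pushed⁺ : X ∈ atoms A → F ∈ push G X → F ∈ pushed A G
  pushed⁺ i j = ∈-concatMap⁺ (push G) (lose i j)

  push-□ : (□ X) ∈ atoms A → member G (□ X) ≡ true → X ∈ pushed A G × (□ X) ∈ pushed A G
  push-□ {X} i e = pushed⁺ i (subst (X ∈_) (sym eq) (here refl)) ,
                   pushed⁺ i (subst ((□ X) ∈_) (sym eq) (there (here refl)))
    where
    eq : push G (□ X) ≡ X ∷ □ X ∷ []
    eq rewrite e = refl

  push-■ : (■ D) ∈ atoms A → member G (■ D) ≡ true → D ∈ pushed A G × (□ D) ∈ pushed A G
  push-■ {D} i e = pushed⁺ i (at (here refl)) , pushed⁺ i (at (there (here refl)))
    where
    at : F ∈ D ∷ □ D ∷ [] → F ∈ push G (■ D)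
    at j rewrite e = ∈-++⁺ʳ (if member G (□ D) then ■ D ∷ [] else [])
                       (∈-++⁺ʳ (if member G (□ ¬' D) then ¬' (■ D) ∷ [] else []) j)

  push-□■ : (■ D) ∈ atoms A → member G (□ D) ≡ true → (■ D) ∈ pushed A G
  push-□■ {D} i e = pushed⁺ i at
    where
    at : (■ D) ∈ push G (■ D)
    at rewrite e = here refl

  push-□¬ : (■ D) ∈ atoms A → member G (□ ¬' D) ≡ true → (¬' (■ D)) ∈ pushed A G
  push-□¬ {D} i e = pushed⁺ i at
    where
    at : (¬' (■ D)) ∈ push G (■ D)
    at rewrite e = ∈-++⁺ʳ (if member G (□ D) then _ else []) (here refl)

  push-⊥ : (■ D) ∈ atoms A → member G (□ D) ≡ true → member G (■ D) ≡ false → ⊥' ∈ pushed A G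
  push-⊥ {D} i e f = pushed⁺ i at
    where
    at : ⊥' ∈ push G (■ D)
    at rewrite e | f = there (here refl)

-- Truth is required instead of membership: `⊥'` can then never be received, and `¬' (■ D)` is
-- received exactly when `■ D` is absent.
record Pushed (A : Fml) (G H : List Fml) : Set where
  constructor pushing
  field
    receive : ∀ {F} → F ∈ pushed A G → truth H F ≡ true

open Pushed

-- Truth lemma for one component of the pairs

module OneSide (A : Fml) (side : Label → List Fml) where

  type : Tree → List Fml
  type (node ℓ _) = side ℓ

  -- The valuation is constrained only in the direction given by the sign of an occurrence; this
  -- leaves room for one valuation to serve both components.
  data Fits : Tree → Set where
    fits : ∀ {ℓ cs} →
      (∀ {p X} → Letter X → X ∈S[ p ] A → member (side ℓ) X ≡ sgn p → val ℓ X ≡ sgn p) →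
      (∀ {X} → (□ X) ∈ atoms A → member (side ℓ) (□ X) ≡ false → Any (λ c → truth (type c) X ≡ false) cs) →
      All (λ c → Pushed A (side ℓ) (type c) × Fits c) cs →
      Fits (node ℓ cs)

  -- It keeps the predecessor's type at hand, whose boxes control ■ at a leaf.
  data Context : Point → Set where
    root  : ∀ {t} → Context (nothing , t)
    inner : ∀ {ℓ ds t} → Fits (node ℓ ds) → t ∈ ds → Context (just ds , t)

  -- Since `□ X` pushes both X and itself, X spreads from the children to all points below.
  descend : ∀ {ℓ cs x} → Fits (node ℓ cs) → (□ X) ∈ atoms A →
            (∀ {c} → c ∈ cs → truth (type c) X ≡ true × member (type c) (□ X) ≡ true) → Below cs x →
            Fits (proj₂ x) × Context x × truth (type (proj₂ x)) X ≡ true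
  descend f@(fits _ _ ps) i h (child j) = proj₂ (lookup ps j) , inner f j , proj₁ (h j)
  descend (fits _ _ ps) i h (deep {ℓ = ℓ} j b) with lookup ps j
  ... | _ , g@(fits _ _ qs) = descend g i
    (λ k → let r = proj₁ (lookup qs k) ; u , v = push-□ A (side ℓ) i (proj₂ (h j)) in receive r u , receive r v) b

  demand : ∀ {ℓ cs} → Fits (node ℓ cs) → (□ X) ∈ atoms A → member (side ℓ) (□ X) ≡ false →
           ∃ λ c → Below cs (just cs , c) × Fits c × Context (just cs , c) × truth (type c) X ≡ false
  demand f@(fits _ d ps) i e with find (d i e)
  ... | c , j , e′ = c , child j , proj₂ (lookup ps j) , inner f j , e′

  -- Only one direction holds for each polarity.
  truth-lemma : ∀ X {p} → X ∈S[ p ] A → ∀ {x} → Fits (proj₂ x) → Context x →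
                truth (type (proj₂ x)) X ≡ sgn p → sat X x ≡ sgn p
  truth-lemma (var n) o (fits v _ _) _ e = v var o e
  truth-lemma ⊥' o _ _ e = e
  truth-lemma (¬' X) {pos} o f c e =
    cong not (truth-lemma X {neg} (∈S-trans {q = neg} (¬- (∈S-refl X)) o) f c (not-true⁻ e))
  truth-lemma (¬' X) {neg} o f c e =
    cong not (truth-lemma X {pos} (∈S-trans {q = neg} (¬- (∈S-refl X)) o) f c (not-false⁻ e))
  truth-lemma (X ∨' Y) {pos} o {x} f c e with truth (type (proj₂ x)) X in e′
  ... | true rewrite truth-lemma X (∈S-trans (∨ˡ (∈S-refl X)) o) f c e′ = refl
  ... | false rewrite truth-lemma Y (∈S-trans (∨ʳ (∈S-refl Y)) o) f c e with sat X x
  ... | true  = refl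
  ... | false = refl
  truth-lemma (X ∨' Y) {neg} o {x} f c e with truth (type (proj₂ x)) X in e′
  ... | false rewrite truth-lemma X (∈S-trans (∨ˡ (∈S-refl X)) o) f c e′ =
    truth-lemma Y (∈S-trans (∨ʳ (∈S-refl Y)) o) f c e
  truth-lemma (□ X) {pos} o {_ , node ℓ cs} f@(fits _ _ ps) c e = □⁺ X cs λ b →
    let i = ∈S⇒atoms o (here refl)
        u , v = push-□ A (side ℓ) i e
        f′ , c′ , e′ = descend f i (λ j → let r = proj₁ (lookup ps j) in receive r u , receive r v) b
    in truth-lemma X (∈S-trans (□- (∈S-refl X)) o) f′ c′ e′
  truth-lemma (□ X) {neg} o {_ , node ℓ cs} f c e =
    let _ , b , f′ , c′ , e′ = demand f (∈S⇒atoms o (here refl)) e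
    in □-refute X b (truth-lemma X (∈S-trans (□- (∈S-refl X)) o) f′ c′ e′)
  truth-lemma (■ D) {pos} o {_ , node ℓ cs@(_ ∷ _)} f@(fits _ _ ps) c e = □⁺ D cs λ b →
    let i = ∈S⇒atoms o (here refl)
        u , v = push-■ A (side ℓ) i e
        f′ , c′ , e′ = descend f (∈S⇒atoms o (there (here refl)))
                         (λ j → let r = proj₁ (lookup ps j) in receive r u , receive r v) b
    in truth-lemma D (∈S-trans (■- (∈S-refl D)) o) f′ c′ e′
  truth-lemma (■ D) {neg} o {_ , node ℓ cs@(_ ∷ _)} f@(fits _ _ ((r , _) ∷ _)) c e
    with member (side ℓ) (□ D) in e′
  -- With `□ D` present and `■ D` absent, the first child would have to make `⊥'` true.
  ... | true with receive r (push-⊥ A (side ℓ) (∈S⇒atoms o (here refl)) e′ e)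
  ...   | ()
  truth-lemma (■ D) {neg} o {_ , node ℓ cs@(_ ∷ _)} f c e | false =
    let _ , b , f′ , c′ , e″ = demand f (∈S⇒atoms o (there (here refl))) e′
    in □-refute D b (truth-lemma D (∈S-trans (■- (∈S-refl D)) o) f′ c′ e″)
  truth-lemma (■ D) o {nothing , node ℓ []} (fits v _ _) c e = v (■ D) o e
  -- If the predecessor has `□ ¬' D`, it pushes `¬' (■ D)` to this leaf, a contradiction. Otherwise
  -- some sibling satisfies D, so ■ is not forced to be false.
  truth-lemma (■ D) {pos} o {just ds , node ℓ []} (fits v _ _) (inner {ℓ = ℓ′} g@(fits _ _ ps) j) e
    with member (side ℓ′) (□ ¬' D) in e′
  ... | true  = ⊥-elim (true≢false e
    (not-true⁻ (receive (proj₁ (lookup ps j)) (push-□¬ A (side ℓ′) (∈S⇒atoms o (here refl)) e′))))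
  ... | false with demand g (∈S⇒atoms o (there (there (here refl)))) e′
  ... | _ , b , f′ , c′ , e″
    rewrite □-refute (¬' D) b (cong not (truth-lemma D (∈S-trans (■- (∈S-refl D)) o) f′ c′ (not-false⁻ e″)))
    with all (sat D) (below ds)
  ... | true  = refl
  ... | false = v (■ D) o e
  -- Dually, `□ D` would push `■ D` here, and without it some sibling refutes D, so ■ is not forced
  -- to be true.
  truth-lemma (■ D) {neg} o {just ds , node ℓ []} (fits v _ _) (inner {ℓ = ℓ′} g@(fits _ _ ps) j) e
    with member (side ℓ′) (□ D) in e′
  ... | true  = ⊥-elim (true≢false
    (receive (proj₁ (lookup ps j)) (push-□■ A (side ℓ′) (∈S⇒atoms o (here refl)) e′)) e)
  ... | false with demand g (∈S⇒atoms o (there (here refl))) e′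
  ... | _ , b , f′ , c′ , e″
    rewrite □-refute D b (truth-lemma D (∈S-trans (■- (∈S-refl D)) o) f′ c′ e″)
    with all (λ y → not (sat D y)) (below ds)
  ... | true  = refl
  ... | false = v (■ D) o e

-- Separators

-- The sign in `E` is flipped because `E` stands for the negated consequent. For `■ D` only the
-- whole formula is checked: its letters then occur in `A` and `E` along with it.
Lang : Fml → Fml → Pol → Fml → Set
Lang A E p (var n)  = var n ∈S[ p ] A × var n ∈S[ flip p ] E
Lang A E p ⊥'       = ⊤
Lang A E p (¬' C)   = Lang A E (flip p) C
Lang A E p (C ∨' D) = Lang A E p C × Lang A E p D
Lang A E p (□ C)    = Lang A E p C
Lang A E p (■ D)    = (■ D) ∈S[ p ] A × (■ D) ∈S[ flip p ] E

Lang-swap : ∀ {A E} C p → Lang A E p C → Lang E A (flip p) C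
Lang-swap (var n)  pos l = swap l
Lang-swap (var n)  neg l = swap l
Lang-swap ⊥'       p l = tt
Lang-swap (¬' C)   p l = Lang-swap C (flip p) l
Lang-swap (C ∨' D) p (l , m) = Lang-swap C p l , Lang-swap D p m
Lang-swap (□ C)    p l = Lang-swap C p l
Lang-swap (■ D)    pos l = swap l
Lang-swap (■ D)    neg l = swap l

Lang-letter : ∀ {A E} → Letter X → X ∈S[ pos ] A → X ∈S[ neg ] E → Lang A E pos X
Lang-letter var   d e = d , e
Lang-letter (■ D) d e = d , e

Lang-∈S : ∀ {A E p} C → Lang A E p C → Letter X → X ∈S[ q ] C →
          X ∈S[ p · q ] A × X ∈S[ flip (p · q) ] E
Lang-∈S (var n) (a , e) l here-var = a , e
Lang-∈S ⊥' c () here-⊥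
Lang-∈S (¬' C) c () here-¬
Lang-∈S {X = X} {q = q} {A} {E} {p} (¬' C) c l (¬- d) =
  subst (λ r → X ∈S[ r ] A × X ∈S[ flip r ] E) (flip·flip p q) (Lang-∈S C c l d)
Lang-∈S (C ∨' D) c () here-∨
Lang-∈S (C ∨' D) (c , _) l (∨ˡ d) = Lang-∈S C c l d
Lang-∈S (C ∨' D) (_ , c) l (∨ʳ d) = Lang-∈S D c l d
Lang-∈S (□ C) c () here-□
Lang-∈S (□ C) c l (□- d) = Lang-∈S C c l d
Lang-∈S {X = X} {q = q} {A} {E} {p} (■ D) (a , e) l d =
  ∈S-trans d a , subst (X ∈S[_] E) (sym (flip-· p q)) (∈S-trans d e)

record Sep (A E : Fml) (G H : List Fml) : Set where
  constructor sep
  field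
    formula : Fml
    lang    : Lang A E pos formula
    proves  : G ⊢ formula
    refutes : H ⊢ (¬' formula)

Sep-swap : Sep A E G H → Sep E A H G
Sep-swap (sep C l d e) = sep (¬' C) (Lang-swap C pos l) e (¬-intro (absurd (weaken d) (hyp (here refl))))

inconsistent : G ⊢ ⊥' → Sep A E G H
inconsistent d = sep ⊥' tt d (axiom (taut λ _ → refl))

-- If adding X and adding `¬' X` both give separators, their disjunction separates the original
-- pair; otherwise one branch delivers `P`.
split : ∀ Φ → (∀ {G′} → G ⊆ G′ → (∀ {X} → X ∈ Φ → X ∈ G′ ⊎ (¬' X) ∈ G′) → Sep A E G′ H ⊎ P) →
        Sep A E G H ⊎ P
split [] k = k id λ ()
split {G = G} (X ∷ Φ) k
  with split {G = X ∷ G} Φ (λ s δ → k (s ∘ there) λ { (here refl) → inj₁ (s (here refl)) ; (there i) → δ i })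
     | split {G = (¬' X) ∷ G} Φ (λ s δ → k (s ∘ there) λ { (here refl) → inj₂ (s (here refl)) ; (there i) → δ i })
... | inj₂ r | _      = inj₂ r
... | inj₁ _ | inj₂ r = inj₂ r
... | inj₁ (sep C l d e) | inj₁ (sep C′ l′ d′ e′) =
  inj₁ (sep (C ∨' C′) (l , l′) (cases (∨-introˡ d) (∨-introʳ d′)) (¬∨-intro e e′))

-- A completion that falsifies some member of `G` is inconsistent and is separated by `⊥'`; only the
-- others reach the continuation.
saturate : (∀ {F} → F ∈ G → atoms F ⊆ atoms A) →
           (∀ {G′} → Decides A G′ → (∀ {F} → F ∈ G → truth G′ F ≡ true) → Sep A E G′ H ⊎ P) →
           Sep A E G H ⊎ P
saturate {G = G} {A = A} {E = E} {H = H} {P = P} c k = split (atoms A) complete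
  where
  complete : ∀ {G′} → G ⊆ G′ → (∀ {X} → X ∈ atoms A → X ∈ G′ ⊎ (¬' X) ∈ G′) → Sep A E G′ H ⊎ P
  complete {G′} s δ with any? (λ F → truth G′ F ≟ᵇ false) G
  ... | yes a = let F , i , e = find a in
    inj₁ (inconsistent (absurd (hyp (s i)) (proj₂ (truth-derivable {A} (deciding δ) F (c i)) e)))
  ... | no n = k (deciding δ) λ i → ≢false⇒true λ e → n (lose i e)

saturate₂ : (∀ {F} → F ∈ G → atoms F ⊆ atoms A) → (∀ {F} → F ∈ H → atoms F ⊆ atoms E) →
            (∀ {G′ H′} → Decides A G′ → (∀ {F} → F ∈ G → truth G′ F ≡ true) →
                         Decides E H′ → (∀ {F} → F ∈ H → truth H′ F ≡ true) → Sep A E G′ H′ ⊎ P) →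
            Sep A E G H ⊎ P
saturate₂ c d k =
  saturate c λ δ s → map₁ Sep-swap (saturate d λ ε t → map₁ Sep-swap (k δ s ε t))

-- Löb's axiom lets the successor refuting X contain □X; this makes the number of boxes outside
-- the type decrease, while the language of the separator ignores the added □X.
jump : (□ X) ∈ atoms A → member G (□ X) ≡ false → Decides A G → Decides E H →
       (∀ {G′ H′} → Decides A G′ → Decides E H′ → Pushed A G G′ → Pushed E H H′ →
          member G′ (□ X) ≡ true → truth G′ X ≡ false → Sep A E G′ H′ ⊎ P) →
       Sep A E G H ⊎ P
jump {X = X} {A = A} {G = G} {E = E} {H = H} i e δ ε k = map₁ diamond
  (saturate₂ closed (proj₂ ∘ pushed-derivable E ε) λ δ′ s ε′ t →
    k δ′ ε′ (pushing (s ∘ there ∘ there)) (pushing t) (s (there (here refl))) (not-true⁻ (s (here refl))))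
  where
  start : List Fml
  start = (¬' X) ∷ (□ X) ∷ pushed A G

  closed : F ∈ start → atoms F ⊆ atoms A
  closed (here refl)         = atoms-closed A i ∘ there
  closed (there (here refl)) = atoms-closed A i
  closed (there (there j))   = proj₂ (pushed-derivable A δ j)

  diamond : Sep A E start (pushed E H) → Sep A E G H
  -- Given `□ ¬' C`, the formula `boxed` yields `□ (□ X ⇒ X)`, hence `□ X` by Löb, which `G`
  -- refutes. On the other side `H` proves `□ ¬' C`. The two negations in `◇ C` cancel in sign, so
  -- `l` is reused.
  diamond (sep C l d d′) = sep (◇ C) l
    (¬-intro (absurd (app (axiom (axL X)) (app (app (axiom (axK _ _)) (weaken boxed)) (hyp (here refl))))
                     (weaken (refuted δ i e))))
    (¬-intro (absurd (weaken (box (proj₁ ∘ pushed-derivable E ε) d′)) (hyp (here refl))))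
    where
    boxed : G ⊢ (□ (¬' C ⇒ (□ X ⇒ X)))
    boxed = box (proj₁ ∘ pushed-derivable A δ) (deduction (deduction (by-contradiction
      (absurd (cut (λ { (here refl) → hyp (here refl)
                      ; (there (here refl)) → hyp (there (here refl))
                      ; (there (there j)) → hyp (there (there (there j))) }) d)
              (hyp (there (there (here refl))))))))

-- Termination measure: boxes outside a type

unbox : Fml → List Fml
unbox (□ X) = X ∷ []
unbox _     = []

bodies : Fml → List Fml
bodies A = concatMap unbox (atoms A)

bodies⁺ : ∀ A → (□ X) ∈ atoms A → X ∈ bodies A
bodies⁺ A i = ∈-concatMap⁺ unbox (lose i (here refl))

unbox⁻ : ∀ Y → X ∈ unbox Y → Y ≡ □ X
unbox⁻ (□ X) (here refl) = refl

bodies⁻ : ∀ A → X ∈ bodies A → (□ X) ∈ atoms A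
bodies⁻ A j with find (∈-concatMap⁻ unbox {xs = atoms A} j)
... | Y , i , k = subst (_∈ atoms A) (unbox⁻ Y k) i

missing : List Fml → List Fml → ℕ
missing G []       = 0
missing G (X ∷ Xs) = if member G (□ X) then missing G Xs else suc (missing G Xs)

missing-≤ : ∀ Xs → (∀ {X} → X ∈ Xs → member G (□ X) ≡ true → member H (□ X) ≡ true) →
            missing H Xs ≤ missing G Xs
missing-≤ [] h = z≤n
missing-≤ {G} {H} (X ∷ Xs) h with member G (□ X) in e | member H (□ X) in e′
... | true  | true  = missing-≤ Xs (h ∘ there)
... | true  | false = ⊥-elim (true≢false (h (here refl) e) e′)
... | false | true  = m≤n⇒m≤1+n (missing-≤ Xs (h ∘ there))
... | false | false = s≤s (missing-≤ Xs (h ∘ there))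

missing-< : ∀ Xs → (∀ {X} → X ∈ Xs → member G (□ X) ≡ true → member H (□ X) ≡ true) →
            X ∈ Xs → member G (□ X) ≡ false → member H (□ X) ≡ true → missing H Xs < missing G Xs
missing-< {G} {H} (X ∷ Xs) h (here refl) e e′ rewrite e | e′ = s≤s (missing-≤ Xs (h ∘ there))
missing-< {G} {H} (Y ∷ Xs) h (there i) e e′ with member G (□ Y) in f | member H (□ Y) in f′
... | true  | true  = missing-< Xs (h ∘ there) i e e′
... | true  | false = ⊥-elim (true≢false (h (here refl) f) f′)
... | false | true  = m≤n⇒m≤1+n (missing-< Xs (h ∘ there) i e e′)
... | false | false = s≤s (missing-< Xs (h ∘ there) i e e′)

-- Boxes push themselves, so the measure never grows along successors.
Pushed-boxes : Pushed A G H → X ∈ bodies A → member G (□ X) ≡ true → member H (□ X) ≡ true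
Pushed-boxes {A} {G} r j e = receive r (proj₂ (push-□ A G (bodies⁻ A j) e))

-- Amalgamation

-- The default value is true: this is what ■-necessitation needs at a root.
value : Fml → Fml → List Fml → List Fml → Fml → Bool
value A E G H X = not ((member (letters A neg) X ∧ not (member G X)) ∨
                       (member (letters E neg) X ∧ not (member H X)))

value-true : ∀ A E G H → (X ∈S[ neg ] A → member G X ≡ true) → (X ∈S[ neg ] E → member H X ≡ true) →
             value A E G H X ≡ true
value-true {X} A E G H h k with member (letters A neg) X in e | member (letters E neg) X in e′
... | false | false = refl
... | false | true
  rewrite k (proj₂ (letters-sound E neg (member⁻ _ X e′))) = refl
... | true | false
  rewrite h (proj₂ (letters-sound A neg (member⁻ _ X e))) = refl
... | true | true
  rewrite h (proj₂ (letters-sound A neg (member⁻ _ X e)))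
        | k (proj₂ (letters-sound E neg (member⁻ _ X e′))) = refl

Compatible : Fml → Fml → List Fml → List Fml → Set
Compatible A E G H = ∀ {X} → Letter X → X ∈S[ pos ] A → X ∈S[ neg ] E → member G X ≡ true → member H X ≡ true

-- For a positive occurrence, `G` contains X and compatibility keeps the other component from making
-- it false; a negative occurrence outside `G` makes the value false by itself.
value-left : ∀ A E G H → Compatible A E G H → Letter X → X ∈S[ p ] A → member G X ≡ sgn p →
             value A E G H X ≡ sgn p
value-left {p = pos} A E G H c l d e = value-true A E G H (λ _ → e) (λ d′ → c l d d′ e)
value-left {p = neg} A E G H c l d e rewrite member⁺ (letters-complete l d) | e = refl

value-comm : ∀ A E G H X → value A E G H X ≡ value E A H G X
value-comm A E G H X = cong not (∨-comm (member (letters A neg) X ∧ not (member G X)) _)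

-- A violating letter lies in the common language and is itself a separator.
compatible? : ∀ A E G H → Decides E H → Sep A E G H ⊎ Compatible A E G H
compatible? A E G H ε
  with any? (λ X → (X ∈? letters E neg) ×-dec ((member G X ≟ᵇ true) ×-dec (member H X ≟ᵇ false))) (letters A pos)
... | yes a =
  let X , i , j , e , f = find a
      l , d = letters-sound A pos i
      _ , d′ = letters-sound E neg j
  in inj₁ (sep X (Lang-letter l d d′) (hyp (member⁻ G X e)) (refuted ε (letter∈atoms l d′) f))
... | no n = inj₂ λ l d d′ e → ≢false⇒true λ f →
  n (lose (letters-complete l d) (letters-complete l d′ , e , f))

collect : ∀ {S : Set} {Q : Tree → Set} {R : Fml → Tree → Set} G Xs →
          (∀ {X} → X ∈ Xs → member G (□ X) ≡ false → S ⊎ (∃ λ c → Q c × R X c)) →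
          S ⊎ (∃ λ cs → All Q cs × (∀ {X} → X ∈ Xs → member G (□ X) ≡ false → Any (R X) cs))
collect G [] f = inj₂ ([] , [] , λ ())
collect G (X ∷ Xs) f with collect G Xs (f ∘ there) | member G (□ X) in e
... | inj₁ s | _ = inj₁ s
... | inj₂ (cs , qs , r) | true =
  inj₂ (cs , qs , λ { (here refl) e′ → ⊥-elim (true≢false e e′) ; (there i) → r i })
... | inj₂ (cs , qs , r) | false with f (here refl) e
... | inj₁ s = inj₁ s
... | inj₂ (c , q , r′) = inj₂ (c ∷ cs , q ∷ qs , λ { (here refl) _ → here r′ ; (there i) e′ → there (r i e′) })

_>>=_ : ∀ {S T U : Set} → S ⊎ T → (T → S ⊎ U) → S ⊎ U
x >>= k = [ inj₁ , k ]′ x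

module Amalgam (A E : Fml) where

  module L = OneSide A left
  module R = OneSide E right

  label : List Fml → List Fml → Label
  label G H = record { left = G ; right = H ; val = value A E G H }

  Child : List Fml → List Fml → Tree → Set
  Child G H c = (Pushed A G (L.type c) × L.Fits c) × (Pushed E H (R.type c) × R.Fits c)

  Model : List Fml → List Fml → Set
  Model G H = ∃ λ cs → L.Fits (node (label G H) cs) × R.Fits (node (label G H) cs)

  -- Each demanded successor lowers the count on the demanding side without raising the other. It
  -- receives the pushes of both components, so a single list of children fits both.
  build : ∀ n {G H} → Decides A G → Decides E H → missing G (bodies A) + missing H (bodies E) < n →
          Sep A E G H ⊎ Model G H
  build (suc n) {G} {H} δ ε (s≤s m) = do
    κ ← compatible? A E G H ε
    -- Exchanging the roles covers letters negative in `A` and positive in `E`.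
    κ′ ← map₁ Sep-swap (compatible? E A H G δ)
    cs , qs , d ← collect G (bodies A) childˡ
    cs′ , qs′ , d′ ← collect H (bodies E) childʳ
    inj₂ (cs ++ cs′ ,
      L.fits (value-left A E G H κ) (λ i e → ++⁺ˡ (d (bodies⁺ A i) e)) (All.map proj₁ (All.++⁺ qs qs′)) ,
      R.fits (λ {_} {X} l o e → trans (value-comm A E G H X) (value-left E A H G κ′ l o e))
             (λ i e → ++⁺ʳ cs (d′ (bodies⁺ E i) e)) (All.map proj₂ (All.++⁺ qs qs′)))
    where
    childˡ : X ∈ bodies A → member G (□ X) ≡ false →
             Sep A E G H ⊎ (∃ λ c → Child G H c × truth (L.type c) X ≡ false)
    childˡ i e = jump (bodies⁻ A i) e δ ε λ δ′ ε′ r r′ f f′ →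
      map₂ (λ (cs , l , r″) → node _ cs , ((r , l) , (r′ , r″)) , f′)
        (build n δ′ ε′ (≤-trans (+-mono-<-≤ (missing-< (bodies A) (Pushed-boxes r) i e f)
                                            (missing-≤ (bodies E) (Pushed-boxes r′))) m))

    childʳ : X ∈ bodies E → member H (□ X) ≡ false →
             Sep A E G H ⊎ (∃ λ c → Child G H c × truth (R.type c) X ≡ false)
    childʳ i e = map₁ Sep-swap (jump (bodies⁻ E i) e ε δ λ ε′ δ′ r′ r f f′ →
      map Sep-swap (λ (cs , l , r″) → node _ cs , ((r , l) , (r′ , r″)) , f′)
        (build n δ′ ε′ (≤-trans (+-mono-≤-< (missing-≤ (bodies A) (Pushed-boxes r))
                                            (missing-< (bodies E) (Pushed-boxes r′) i e f)) m)))

-- The list consists of the ■D ∈ atoms A that hold at every root by ■-necessitation.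
record Theorems (A : Fml) : Set where
  field
    list     : List Fml
    provable : F ∈ list → GR°⊢ F
    closed   : F ∈ list → atoms F ⊆ atoms A
    complete : (■ D) ∈ atoms A → GR°⊢ D → (■ D) ∈ list

open Theorems

-- Separation at the root and decidability of provability

Countermodel : Fml → Fml → Set
Countermodel A E = ∃ λ x → Admissible x × sat A x ≡ true × sat E x ≡ true

-- The provable ■-formulas are added to the initial types to make the root admissible; being
-- theorems, they are discharged from a separator.
separate : Theorems A → Theorems E → Sep A E (A ∷ []) (E ∷ []) ⊎ Countermodel A E
separate {A} {E} θ η = map₁ discharge
  (saturate₂ (λ { (here refl) → id ; (there i) → closed θ i })
             (λ { (here refl) → id ; (there i) → closed η i })
             λ δ s ε t → map₂ (model s t) (build _ δ ε ≤-refl))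
  where
  open Amalgam A E

  discharge : Sep A E (A ∷ list θ) (E ∷ list η) → Sep A E (A ∷ []) (E ∷ [])
  discharge (sep C l d e) = sep C l
    (cut (λ { (here refl) → hyp (here refl) ; (there i) → thm (provable θ i) }) d)
    (cut (λ { (here refl) → hyp (here refl) ; (there i) → thm (provable η i) }) e)

  model : (∀ {F} → F ∈ A ∷ list θ → truth G F ≡ true) → (∀ {F} → F ∈ E ∷ list η → truth H F ≡ true) →
          Model G H → Countermodel A E
  model {G} {H} s t (cs , l , r) = (nothing , node (label G H) cs) ,
    -- A provable D has `■ D` in each type where it occurs negatively; in the remaining cases the
    -- default value is true.
    root (λ {D} d → value-true A E G H
      (λ o → s (there (complete θ (letter∈atoms (■ D) o) d)))
      (λ o → t (there (complete η (letter∈atoms (■ D) o) d)))) ,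
    L.truth-lemma A (∈S-refl A) l L.root (s (here refl)) ,
    R.truth-lemma E (∈S-refl E) r R.root (t (here refl))

no-theorems : (∀ {D} → (■ D) ∉ atoms A) → Theorems A
no-theorems n = record { list = [] ; provable = λ () ; closed = λ () ; complete = λ i _ → ⊥-elim (n i) }

Theorems-¬ : Theorems A → Theorems (¬' A)
Theorems-¬ θ = record { list = list θ ; provable = provable θ ; closed = closed θ ; complete = complete θ }

-- A separator of `¬' ⊥'` and `¬' A` is a theorem C with `¬' C` derivable from `¬' A`, which proves
-- A; a countermodel refutes A by soundness.
decide-theorem : Theorems A → Dec (GR°⊢ A)
decide-theorem {A} θ = [ yes ∘ derivable , no ∘ refutable ]′ (separate (no-theorems λ ()) (Theorems-¬ θ))
  where
  derivable : Sep (¬' ⊥') (¬' A) ((¬' ⊥') ∷ []) ((¬' A) ∷ []) → GR°⊢ A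
  derivable (sep C _ d e) = theorem (by-contradiction
    (absurd (cut (λ { (here refl) → axiom (taut λ _ → refl) }) d) e))

  refutable : Countermodel (¬' ⊥') (¬' A) → ¬ (GR°⊢ A)
  refutable (_ , α , _ , e) d = true≢false (soundness d α) (not-true⁻ e)

Theorems-■ : Theorems A → Dec (GR°⊢ A) → Theorems (■ A)
Theorems-■ {A} θ (yes d) = record
  { list     = ■ A ∷ list θ
  ; provable = λ { (here refl) → nec■ d ; (there i) → provable θ i }
  ; closed   = λ { (here refl) → id ; (there i) → there ∘ there ∘ there ∘ closed θ i }
  ; complete = λ { (here refl) _ → here refl ; (there (there (there i))) d′ → there (complete θ i d′) }
  }
Theorems-■ θ (no n) = record
  { list     = list θ
  ; provable = provable θ
  ; closed   = λ i → there ∘ there ∘ there ∘ closed θ i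
  ; complete = λ { (here refl) d → ⊥-elim (n d) ; (there (there (there i))) d → complete θ i d }
  }

Theorems-∨ : Theorems A → Theorems B → Theorems (A ∨' B)
Theorems-∨ {A} θ η = record
  { list     = list θ ++ list η
  ; provable = [ provable θ , provable η ]′ ∘ ∈-++⁻ (list θ)
  ; closed   = λ i j → [ (λ k → ∈-++⁺ˡ (closed θ k j)) , (λ k → ∈-++⁺ʳ (atoms A) (closed η k j)) ]′ (∈-++⁻ (list θ) i)
  ; complete = λ i d → [ (λ k → ∈-++⁺ˡ (complete θ k d)) , (λ k → ∈-++⁺ʳ (list θ) (complete η k d)) ]′ (∈-++⁻ (atoms A) i)
  }

Theorems-□ : Theorems A → Theorems (□ A)
Theorems-□ θ = record
  { list     = list θ
  ; provable = provable θ
  ; closed   = λ i → there ∘ closed θ i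
  ; complete = λ { (there i) → complete θ i }
  }

-- Deciding whether ⊢ D uses the countermodel construction for D, whose roots only involve
-- the ■-subformulas of D: hence the recursion.
theorems : ∀ A → Theorems A
theorems (var n)  = no-theorems λ { (here ()) ; (there ()) }
theorems ⊥'       = no-theorems λ ()
theorems (¬' A)   = Theorems-¬ (theorems A)
theorems (A ∨' B) = Theorems-∨ (theorems A) (theorems B)
theorems (□ A)    = Theorems-□ (theorems A)
theorems (■ A)    = Theorems-■ (theorems A) (decide-theorem (theorems A))

-- Lyndon interpolants from separators

theorem4p2 : (A B : Fml) → GR°⊢ (A ⇒ B) →
    Σ Fml (λ C →
    ((p : Pol) (n : ℕ) → n ∈v[ p ] C → (n ∈v[ p ] A) × (n ∈v[ p ] B))
    × (GR°⊢ (A ⇒ C))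
    × (GR°⊢ (C ⇒ B))
    × ((p : Pol) (D : Fml) → (■ D) ∈S[ p ] C → ((■ D) ∈S[ p ] A) × ((■ D) ∈S[ p ] B)))
theorem4p2 A B d = [ interpolant , ⊥-elim ∘ no-countermodel ]′ (separate (theorems A) (theorems (¬' B)))
  where
  no-countermodel : ¬ Countermodel A (¬' B)
  no-countermodel (_ , α , a , b) = true≢false (⇒⁻ (soundness d α) a) (not-true⁻ b)

  unflip : Letter X → X ∈S[ flip p ] (¬' B) → X ∈S[ p ] B
  unflip {p = pos} l (¬- o) = o
  unflip {p = neg} l (¬- o) = o

  -- Variables and ■-formulas are both letters, so this settles both conditions on the interpolant.
  shared : ∀ C → Lang A (¬' B) pos C → Letter X → X ∈S[ p ] C → X ∈S[ p ] A × X ∈S[ p ] B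
  shared {p = p} C c l o with Lang-∈S C c l o
  ... | a , e rewrite pos· p = a , unflip l e

  interpolant : Sep A (¬' B) (A ∷ []) ((¬' B) ∷ []) → _
  interpolant (sep C c e f) =
    C , (λ p n → shared C c var) , theorem (deduction e) , theorem (contrapose (deduction f)) ,
    (λ p D → shared C c (■ D))
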